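{- Let $G$ be a connected graph and let $m\in\mathbb{N}$ with $m>1$. (a) If $m$ is even and $\Delta(G)\geq 4$, then $\chi(G^{\frac{m}{n}})=\omega(G^{\frac{m}{n}})$ for every integer $n\geq 2m+2$. (b) If $m$ is odd and $\Delta(G)\geq 5$, then $\chi(G^{\frac{m}{n}})=\omega(G^{\frac{m}{n}})$ for every integer $n\geq 2m+2$.
   Context: All graphs are finite and simple; $\Delta$ is the maximum degree, $\chi$ the chromatic number, $\omega$ the clique number. For a graph $H$ and $m\in\mathbb{N}$, the $m$-power $H^m$ has vertex set $V(H)$, with distinct vertices $x,y$ adjacent iff $1\le d_H(x,y)\le m$. For $n\in\mathbb{N}$, the $n$-subdivision $G^{\frac1n}$ is obtained from $G$ by replacing each edge by a path of length $n$. The fractional power $G^{\frac{m}{n}}$ is $(G^{\frac1n})^m$. -}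

module Defs where

open import Data.Nat using (ℕ; zero; suc; _+_; _*_; _∸_; _≤_; _<_)
open import Data.Fin using (Fin; toℕ)
open import Data.Product using (Σ; ∃; _×_; _,_; proj₁; proj₂)
open import Data.Sum using (_⊎_; inj₁; inj₂)
open import Data.Empty using (⊥)
open import Relation.Nullary using (¬_)
open import Relation.Binary.Definitions using (Decidable)
open import Relation.Binary.PropositionalEquality using (_≡_; refl; sym; trans; cong)
open import Function.Bundles using (_↔_; Inverse)
open import Data.Nat.Properties using (n<1+n; <-irrefl)

record Graph : Set₁ where
  field
    V      : Set
    Adj    : V → V → Set
    symAdj : ∀ {x y} → Adj x y → Adj y x
    irrAdj : ∀ {x} → ¬ Adj x x
open Graph public

record FinGraph : Set₁ where
  field
    graph  : Graph
    N      : ℕ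
    enum   : V graph ↔ Fin N
    adj?   : Decidable (Adj graph)
    -- adjacency is a proposition (a simple graph has at most one edge x~y)
    adjProp : ∀ {x y} (p q : Adj graph x y) → p ≡ q
open FinGraph public

data Walk (H : Graph) : V H → V H → ℕ → Set where
  here : ∀ {x} → Walk H x x 0
  step : ∀ {x y z k} → Adj H x y → Walk H y z k → Walk H x z (suc k)

snocW : ∀ {H x y z k} → Walk H x y k → Adj H y z → Walk H x z (suc k)
snocW here a = step a here
snocW (step b w) a = step b (snocW w a)

revW : ∀ {H x y k} → Walk H x y k → Walk H y x k
revW here = here
revW {H} (step a w) = snocW (revW w) (symAdj H a)

Connected : Graph → Set
Connected H = ∀ x y → ∃ λ k → Walk H x y k

-- m-th power: x ~ y iff x ≠ y and 1 ≤ d_H(x,y) ≤ m,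
-- i.e. there is a walk of length k with 1 ≤ k ≤ m.

PowAdj : (H : Graph) → ℕ → V H → V H → Set
PowAdj H m x y = ¬ (x ≡ y) × (∃ λ k → 1 ≤ k × k ≤ m × Walk H x y k)

power : Graph → ℕ → Graph
power H m = record
  { V = V H
  ; Adj = PowAdj H m
  ; symAdj = λ { (ne , k , p , q , w) → (λ e → ne (sym e)) , k , p , q , revW w }
  ; irrAdj = λ { (ne , _) → ne refl }
  }

-- n-subdivision.  Each edge {u,v} is stored once, oriented so that
-- index u < index v (index via the enumeration).  Interior vertex (e , j),
-- j : Fin (n ∸ 1), is the vertex at distance (toℕ j + 1) from u on the
-- path of length n replacing e.

module _ (G : FinGraph) where
  private
    H = graph G
    idx : V H → ℕ
    idx x = toℕ (Inverse.to (enum G) x)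

  record Edge : Set where
    constructor edge
    field
      eu ev : V H
      eadj : Adj H eu ev
      eord : idx eu < idx ev

  open Edge

  SubV : ℕ → Set
  SubV n = V H ⊎ (Edge × Fin (n ∸ 1))

  Half : (n : ℕ) → SubV n → SubV n → Set
  Half n (inj₁ x) (inj₁ y) = (n ≡ 1) × Adj H x y
  Half n (inj₁ x) (inj₂ (e , j)) =
    (x ≡ eu e × toℕ j ≡ 0) ⊎ (x ≡ ev e × suc (toℕ j) ≡ n ∸ 1)
  Half n (inj₂ _) (inj₁ _) = ⊥
  Half n (inj₂ (e , i)) (inj₂ (f , j)) =
    eu e ≡ eu f × ev e ≡ ev f × suc (toℕ i) ≡ toℕ j

  private
    halfIrr : ∀ n a → ¬ Half n a a
    halfIrr n (inj₁ x) (_ , a) = irrAdj H a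
    halfIrr n (inj₂ (e , i)) (_ , _ , p) = <-irrefl (sym p) (n<1+n (toℕ i))

    swap : ∀ {A B : Set} → A ⊎ B → B ⊎ A
    swap (inj₁ a) = inj₂ a
    swap (inj₂ b) = inj₁ b

    orIrr : ∀ n a → ¬ (Half n a a ⊎ Half n a a)
    orIrr n a (inj₁ h) = halfIrr n a h
    orIrr n a (inj₂ h) = halfIrr n a h

  subdivision : ℕ → Graph
  subdivision n = record
    { V = SubV n
    ; Adj = λ a b → Half n a b ⊎ Half n b a
    ; symAdj = swap
    ; irrAdj = λ {a} → orIrr n a
    }

fracPower : FinGraph → ℕ → ℕ → Graph
fracPower G m n = power (subdivision G n) m

MaxDegreeAtLeast : Graph → ℕ → Set
MaxDegreeAtLeast H d =
  ∃ λ v → Σ (Fin d → V H) λ f →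
    (∀ i j → f i ≡ f j → i ≡ j) × (∀ i → Adj H v (f i))

Colourable : Graph → ℕ → Set
Colourable H k = Σ (V H → Fin k) λ c → ∀ x y → Adj H x y → ¬ (c x ≡ c y)

HasClique : Graph → ℕ → Set
HasClique H k = Σ (Fin k → V H) λ f → ∀ i j → ¬ (i ≡ j) → Adj H (f i) (f j)

IsChromaticNumber : Graph → ℕ → Set
IsChromaticNumber H k = Colourable H k × (∀ j → Colourable H j → k ≤ j)

IsCliqueNumber : Graph → ℕ → Set
IsCliqueNumber H k = HasClique H k × (∀ j → HasClique H j → j ≤ k)

ChiEqOmega : Graph → Set
ChiEqOmega H = ∃ λ k → IsChromaticNumber H k × IsCliqueNumber H k

Even Odd : ℕ → Set
Even m = ∃ λ k → m ≡ 2 * k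
Odd m = ∃ λ k → m ≡ suc (2 * k)

module Submission where

-- Write m = 2k + ε with ε ∈ {0, 1}. A branch vertex of maximum degree Δ, the k nearest points on
-- each of its Δ edges and, for odd m, one point at distance k + 1 form a clique of size
-- 1 + ε + Δk, so it suffices to colour with that many colours: one for all branch vertices, one
-- for all points at distance k + 1 if m is odd, and (a , i) for a < Δ, i < k.
--
-- Every vertex labels its incident edges injectively by numbers below Δ. If the ends of an edge
-- label it a and b, pick spare labels x ≠ a and y ≠ b with x ≠ y. The first m + 1 points from the
-- first end get 0, a₁, …, aₖ, (∗,) xₖ, …, x₁, and likewise with b and y from the other end: legs at
-- a common vertex then never clash within distance m, nor do the two ends of an edge. The points
-- in between, present since n ≥ 2m + 2, are coloured greedily: each has at most 2m coloured
-- points within distance m, and 2m < 1 + ε + Δk because Δ ≥ 4 + ε.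

open import Defs
open import Data.Nat using (ℕ; zero; suc; _+_; _*_; _∸_; _≤_; _<_; z≤n; s≤s; _≤?_)
open import Data.Nat.Properties
open import Data.Nat.Tactic.RingSolver using (solve)
open import Data.Fin as Fin using (Fin; zero; suc; toℕ; fromℕ; fromℕ<)
open import Data.Fin.Properties as Finₚ using (toℕ<n; toℕ-fromℕ<; toℕ-injective)
open import Data.List using (List; []; _∷_; allFin; filter; length; lookup; map)
open import Data.List.Extrema ≤-totalOrder using (argmax; f[xs]≤f[argmax])
open import Data.List.Membership.Propositional using (_∈_)
open import Data.List.Membership.Propositional.Properties
  using (∈-filter⁺; ∈-filter⁻; ∈-map⁺; ∈-allFin; ∈-lookup)
import Data.List.Relation.Unary.All as All
open import Data.List.Relation.Unary.Any using (index)
open import Data.List.Relation.Unary.Any.Properties using (lookup-index)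
import Data.List.Relation.Unary.AllPairs as AllPairs
open import Data.List.Relation.Unary.Unique.Propositional using (Unique)
import Data.List.Relation.Unary.Unique.Propositional.Properties as Uniqueₚ
open import Data.Product using (∃; _×_; _,_; proj₁; proj₂)
open import Data.Sum using (_⊎_; inj₁; inj₂)
open import Data.Empty using (⊥-elim)
open import Data.Sum.Properties using (inj₁-injective; inj₂-injective)
open import Data.Sum.Function.Propositional using (_⊎-↔_)
open import Function.Base using (_∘_)
open import Function.Bundles using (_↔_; Inverse)
open import Function.Construct.Composition using (_↔-∘_)
open import Function.Construct.Identity using (↔-id)
open import Relation.Binary.Definitions using (tri<; tri≈; tri>)
open import Relation.Nullary using (¬_; yes; no; contradiction)
open import Relation.Nullary.Decidable using (decidable-stable)
open import Relation.Binary.PropositionalEquality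
  using (_≡_; _≢_; refl; sym; trans; cong; cong₂; subst; subst₂)

-- Linear inequalities and the pigeonhole principle.

-- Farkas certificate: p ≤ q follows from A ≤ B when q − p = B − A + r.
farkas : ∀ {p q A B} → A ≤ B → ∀ r → A + q ≡ B + (p + r) → p ≤ q
farkas {p} {q} {A} {B} A≤B r eq = ≤-trans (m≤m+n p r)
  (+-cancelˡ-≤ B (p + r) q (subst (_≤ B + q) eq (+-monoˡ-≤ q A≤B)))

absurd-≤ : ∀ {A B} {P : Set} → A ≤ B → ∀ r → A ≡ B + suc r → P
absurd-≤ {A} A≤B r eq = ⊥-elim (n≮0 (farkas {1} {0} A≤B r (trans (+-identityʳ A) eq)))

-- If `g` hit every colour, choosing preimages would inject `Fin N` into `Fin r`.
fresh : ∀ {r N} → r < N → (g : Fin r → Fin N) → ∃ λ c → ∀ i → g i ≢ c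
fresh {N = N} r<N g
  with Finₚ.¬∀⟶∃¬ N (λ c → ∃ λ i → g i ≡ c) (λ c → Finₚ.any? (λ i → g i Fin.≟ c))
    (λ onto → <⇒≱ r<N (Finₚ.injective⇒≤ {f = proj₁ ∘ onto} (λ {c} {c′} eq →
      trans (sym (proj₂ (onto c))) (trans (cong g eq) (proj₂ (onto c′))))))
... | c , c∉g = c , λ i eq → c∉g (i , eq)

-- Greedy colouring along a path.

-- The positions below s, and those within distance m of the far end n, are coloured.
module Greedy {N m n : ℕ} (2m<N : m + m < N) where

  Coloured : ℕ → ℕ → Set
  Coloured s p = p < s ⊎ n ≤ p + m

  ProperOn : (ℕ → Set) → (ℕ → Fin N) → Set
  ProperOn P f = ∀ {p q} → p < q → q ≤ n → q ≤ p + m → P p → P q → f p ≢ f q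

  update : ℕ → Fin N → (ℕ → Fin N) → ℕ → Fin N
  update s c f p with p ≟ s
  ... | yes _ = c
  ... | no _ = f p

  update-≢ : ∀ {s p} c f → p ≢ s → update s c f p ≡ f p
  update-≢ {s} {p} c f p≢s with p ≟ s
  ... | yes p≡s = contradiction p≡s p≢s
  ... | no _ = refl

  coloured-suc : ∀ {s p} → p ≢ s → Coloured (suc s) p → Coloured s p
  coloured-suc p≢s (inj₁ (s≤s p≤s)) = inj₁ (≤∧≢⇒< p≤s p≢s)
  coloured-suc p≢s (inj₂ h) = inj₂ h

  extend₁ : ∀ {s f} → ProperOn (Coloured s) f →
    ∃ λ f′ → ProperOn (Coloured (suc s)) f′ × (∀ {p} → Coloured s p → f′ p ≡ f p)
  extend₁ {s} {f} proper with n ≤? s + m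
  -- Position `s` already belongs to the precoloured far end, so the frontier passes it without
  -- recolouring.
  ... | yes n≤s+m = f , (λ p<q q≤n q≤p+m P Q → proper p<q q≤n q≤p+m (old P) (old Q)) , λ _ → refl
    where
    old : ∀ {p} → Coloured (suc s) p → Coloured s p
    old {p} P with p ≟ s
    ... | yes refl = inj₂ n≤s+m
    ... | no p≢s = coloured-suc p≢s P
  ... | no n≰s+m = f′ , proper′ , λ P → update-≢ c f (λ { refl → uncoloured P })
    where
    -- The m positions on either side of `s`. Truncated subtraction may repeat position 0, and
    -- positions still uncoloured are avoided too; both only forbid more than necessary, and 2m
    -- values still leave a colour free.
    nearby : Fin m ⊎ Fin m → ℕ
    nearby (inj₁ i) = s ∸ suc (toℕ i)
    nearby (inj₂ i) = s + suc (toℕ i)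

    avoid = fresh 2m<N (f ∘ nearby ∘ Fin.splitAt m)
    c = proj₁ avoid
    f′ = update s c f

    c-fresh : ∀ i → f (nearby i) ≢ c
    c-fresh i = subst (λ j → f (nearby j) ≢ c) (Finₚ.splitAt-join m m i)
      (proj₂ avoid (Fin.join m m i))

    uncoloured : ¬ Coloured s s
    uncoloured (inj₁ s<s) = <-irrefl refl s<s
    uncoloured (inj₂ n≤) = n≰s+m n≤

    below : ∀ {p} → p < s → s ≤ p + m → f p ≢ c
    below {p} p<s s≤p+m = subst (λ x → f x ≢ c) eq (c-fresh (inj₁ (fromℕ< i<m)))
      where
      i = s ∸ suc p
      si : suc p + i ≡ s
      si = m+[n∸m]≡n p<s
      i<m : i < m
      i<m = +-cancelˡ-≤ p (suc i) m (subst (_≤ p + m) (trans (sym si) (sym (+-suc p i))) s≤p+m)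
      eq : s ∸ suc (toℕ (fromℕ< i<m)) ≡ p
      eq = trans (cong₂ _∸_ (trans (sym si) (sym (+-suc p i))) (cong suc (toℕ-fromℕ< i<m)))
        (m+n∸n≡m p (suc i))

    above : ∀ {q} → s < q → q ≤ s + m → f q ≢ c
    above {q} s<q q≤s+m = subst (λ x → f x ≢ c) eq (c-fresh (inj₂ (fromℕ< i<m)))
      where
      i = q ∸ suc s
      si : s + suc i ≡ q
      si = trans (+-suc s i) (m+[n∸m]≡n s<q)
      i<m : i < m
      i<m = +-cancelˡ-≤ s (suc i) m (subst (_≤ s + m) (sym si) q≤s+m)
      eq : s + suc (toℕ (fromℕ< i<m)) ≡ q
      eq = trans (cong (λ x → s + suc x) (toℕ-fromℕ< i<m)) si

    proper′ : ProperOn (Coloured (suc s)) f′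
    proper′ {p} {q} p<q q≤n q≤p+m P Q eq with p ≟ s | q ≟ s
    ... | yes refl | yes refl = <-irrefl refl p<q
    ... | yes refl | no _ = above p<q q≤p+m (sym eq)
    ... | no _ | yes refl = below p<q q≤p+m eq
    ... | no p≢s | no q≢s = proper p<q q≤n q≤p+m (coloured-suc p≢s P) (coloured-suc q≢s Q) eq

  extend* : ∀ t {s f} → ProperOn (Coloured s) f →
    ∃ λ f′ → ProperOn (Coloured (t + s)) f′ × (∀ {p} → Coloured s p → f′ p ≡ f p)
  extend* zero {f = f} proper = f , proper , λ _ → refl
  extend* (suc t) {s} proper =
    let f₁ , proper₁ , agree₁ = extend* t proper
        f₂ , proper₂ , agree₂ = extend₁ proper₁
    in f₂ , proper₂ , λ P → trans (agree₂ (weaken P)) (agree₁ P)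
    where
    weaken : ∀ {p} → Coloured s p → Coloured (t + s) p
    weaken (inj₁ p<s) = inj₁ (≤-trans p<s (m≤n+m s t))
    weaken (inj₂ h) = inj₂ h

  extend : ∀ {s f} → ProperOn (Coloured s) f →
    ∃ λ f′ → (∀ {p q} → p < q → q ≤ n → q ≤ p + m → f′ p ≢ f′ q)
           × (∀ {p} → Coloured s p → f′ p ≡ f p)
  -- From any `s`, `suc n` steps carry the frontier past `n`.
  extend {s} proper with extend* (suc n) proper
  ... | f′ , proper′ , agree =
    f′ , (λ p<q q≤n q≤p+m → proper′ p<q q≤n q≤p+m (all (≤-trans (<⇒≤ p<q) q≤n)) (all q≤n)) , agree
    where
    all : ∀ {p} → p ≤ n → Coloured (suc n + s) p
    all p≤n = inj₁ (s≤s (≤-trans p≤n (m≤m+n n s)))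

-- Colours, legs and the colour sequence of an edge.

module Palette (Δ k ε m : ℕ) (ε≤1 : ε ≤ 1) (m≡ε+2k : m ≡ ε + 2 * k) where

  Colour : Set
  Colour = Fin (suc ε) ⊎ (Fin Δ × Fin k)

  #colours : ℕ
  #colours = suc ε + Δ * k

  colours : Fin #colours ↔ Colour
  colours = (↔-id _ ⊎-↔ Finₚ.*↔×) ↔-∘ Finₚ.+↔⊎

  decode : Fin #colours → Colour
  decode = Inverse.to colours

  encode : Colour → Fin #colours
  encode = Inverse.from colours

  decode-injective : ∀ {x y} → decode x ≡ decode y → x ≡ y
  decode-injective {x} {y} eq = trans (sym (Inverse.strictlyInverseʳ colours x))
    (trans (cong encode eq) (Inverse.strictlyInverseʳ colours y))

  encode-injective : ∀ {x y} → encode x ≡ encode y → x ≡ y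
  encode-injective {x} {y} eq = trans (sym (Inverse.strictlyInverseˡ colours x))
    (trans (cong decode eq) (Inverse.strictlyInverseˡ colours y))

  -- Level 0 is the colour of branch vertices; for odd m the colour of level k + 1 is also
  -- independent of the label.
  atLevel′ : Fin Δ → ℕ → Colour
  atLevel′ a zero = inj₁ zero
  atLevel′ a (suc i) with suc i ≤? k
  ... | yes i<k = inj₂ (a , fromℕ< i<k)
  ... | no _ = inj₁ (fromℕ ε)

  atLevel : Fin Δ → ℕ → Fin #colours
  atLevel a i = encode (atLevel′ a i)

  -- For even m, `fromℕ ε` is the branch colour, a junk value of `atLevel′`. A level above `k` but
  -- at most `ε + k` exists only when `ε` is positive, so the junk is never met.
  last≢zero : ∀ {i} → ¬ (suc i ≤ k) → suc i ≤ ε + k → fromℕ ε ≢ zero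
  last≢zero {i} i≮k i<ε+k eq =
    i≮k (subst (λ e → suc i ≤ e + k) (trans (sym (Finₚ.toℕ-fromℕ ε)) (cong toℕ eq)) i<ε+k)

  atLevel′-injective : ∀ {a b i j} → i ≤ ε + k → j ≤ ε + k → atLevel′ a i ≡ atLevel′ b j →
    i ≡ j × (1 ≤ i → i ≤ k → a ≡ b)
  atLevel′-injective {i = zero} {zero} _ _ _ = refl , λ ()
  atLevel′-injective {i = zero} {suc j} _ j≤ eq with suc j ≤? k
  atLevel′-injective {i = zero} {suc j} _ j≤ () | yes _
  ... | no j≮k = contradiction (sym (inj₁-injective eq)) (last≢zero j≮k j≤)
  atLevel′-injective {i = suc i} {zero} i≤ _ eq with suc i ≤? k
  atLevel′-injective {i = suc i} {zero} i≤ _ () | yes _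
  ... | no i≮k = contradiction (inj₁-injective eq) (last≢zero i≮k i≤)
  atLevel′-injective {i = suc i} {suc j} i≤ j≤ eq with suc i ≤? k | suc j ≤? k
  ... | yes p | yes q =
    cong suc (Finₚ.fromℕ<-injective i j p q (cong proj₂ (inj₂-injective eq))) ,
    λ _ _ → cong proj₁ (inj₂-injective eq)
  -- Both levels exceed `k` and are at most `ε + k`, hence both are `k + 1`.
  ... | no p | no q =
    ≤-antisym (≤-trans i≤ (≤-trans (+-monoˡ-≤ k ε≤1) (≰⇒> q)))
      (≤-trans j≤ (≤-trans (+-monoˡ-≤ k ε≤1) (≰⇒> p))) ,
    λ _ i<k → contradiction i<k p

  atLevel-injective : ∀ {a b i j} → i ≤ ε + k → j ≤ ε + k → atLevel a i ≡ atLevel b j →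
    i ≡ j × (1 ≤ i → i ≤ k → a ≡ b)
  atLevel-injective i≤ j≤ eq = atLevel′-injective i≤ j≤ (encode-injective eq)

  -- Colours of the positions 0, …, m on an edge whose near end labels it a: the levels run up
  -- with owner a and then down again with a spare owner x.
  leg : Fin Δ → Fin Δ → ℕ → Fin #colours
  leg a x p with p ≤? k
  ... | yes _ = atLevel a p
  ... | no _ = atLevel x (suc m ∸ p)

  leg-0 : ∀ a x → leg a x 0 ≡ encode (inj₁ zero)
  leg-0 a x with 0 ≤? k
  ... | yes _ = refl
  ... | no 0≰k = contradiction z≤n 0≰k

  -- Exposes the descending level as a successor, so that equations between levels can be matched
  -- and the owner, recorded only at positive levels, can be compared.
  mirror : ∀ {p} → p ≤ m → ∃ λ i → p + suc i ≡ suc m × suc m ∸ p ≡ suc i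
  mirror {p} p≤m = m ∸ p , trans (+-suc p (m ∸ p)) (cong suc (m+[n∸m]≡n p≤m)) , +-∸-assoc 1 p≤m

  low≤ : ∀ {p} → p ≤ k → p ≤ ε + k
  low≤ p≤k = ≤-trans p≤k (m≤n+m k ε)

  high≤ : ∀ {p i} → ¬ (p ≤ k) → p + suc i ≡ suc m → suc i ≤ ε + k
  high≤ {p} {i} p≰k eq = farkas
    (+-mono-≤ (+-mono-≤ (≰⇒> p≰k) (≤-reflexive eq)) (≤-reflexive m≡ε+2k))
    0 (solve (p ∷ i ∷ ε ∷ k ∷ m ∷ []))

  -- Positions p and q have the same level only if p = q or p + q = 1 + m.
  leg-distinct-near : ∀ {a x p q} → a ≢ x → p < q → q ≤ m → leg a x p ≢ leg a x q
  leg-distinct-near {a} {x} {p} {q} a≢x p<q q≤m eq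
    with p ≤? k | q ≤? k | mirror (≤-trans (<⇒≤ p<q) q≤m) | mirror q≤m
  ... | yes u | yes v | _ | _ = <⇒≢ p<q (proj₁ (atLevel-injective (low≤ u) (low≤ v) eq))
  ... | yes u | no v | _ | j , hj , ej rewrite ej
    with atLevel-injective (low≤ u) (high≤ v hj) eq
  ... | refl , a≡x = a≢x (a≡x (s≤s z≤n) u)
  leg-distinct-near {p = p} {q} a≢x p<q q≤m eq | no u | yes v | _ | _ = u (≤-trans (<⇒≤ p<q) v)
  leg-distinct-near {p = p} {q} a≢x p<q q≤m eq | no u | no v | i , hi , ei | j , hj , ej
    rewrite ei | ej with atLevel-injective (high≤ u hi) (high≤ v hj) eq
  ... | refl , _ = <⇒≢ p<q (+-cancelʳ-≡ (suc i) p q (trans hi (sym hj)))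

  -- For legs at opposite ends of one edge. Equal levels would need p = q or p + q = m + 1; the
  -- bound leaves only p = q on the descending halves, at a level at most `k`, where the spare
  -- owners differ.
  leg-distinct-far : ∀ {a b x y p q} → x ≢ y → p ≤ m → q ≤ m → 2 + m ≤ p + q →
    leg a x p ≢ leg b y q
  leg-distinct-far {p = p} {q} x≢y p≤m q≤m far eq
    with p ≤? k | q ≤? k | mirror p≤m | mirror q≤m
  ... | yes u | yes v | _ | _ =
    absurd-≤ (+-mono-≤ far (+-mono-≤ (+-mono-≤ u v) (≤-reflexive (sym m≡ε+2k)))) (suc ε)
      (solve (p ∷ q ∷ ε ∷ k ∷ m ∷ []))
  ... | yes u | no v | _ | j , hj , ej rewrite ej
    with atLevel-injective (low≤ u) (high≤ v hj) eq
  ... | refl , _ = absurd-≤ (+-mono-≤ far (≤-reflexive hj)) 0 (solve (j ∷ q ∷ ε ∷ k ∷ m ∷ []))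
  leg-distinct-far {p = p} {q} x≢y p≤m q≤m far eq | no u | yes v | i , hi , ei | _ rewrite ei
    with atLevel-injective (high≤ u hi) (low≤ v) eq
  ... | refl , _ = absurd-≤ (+-mono-≤ far (≤-reflexive hi)) 0 (solve (i ∷ p ∷ ε ∷ k ∷ m ∷ []))
  leg-distinct-far {p = p} {q} x≢y p≤m q≤m far eq | no u | no v | i , hi , ei | j , hj , ej
    rewrite ei | ej with atLevel-injective (high≤ u hi) (high≤ v hj) eq
  ... | refl , x≡y with +-cancelʳ-≡ (suc i) p q (trans hi (sym hj)) | suc i ≤? k
  ... | refl | yes w = x≢y (x≡y (s≤s z≤n) w)
  ... | refl | no w = absurd-≤
    (+-mono-≤ far (+-mono-≤ (+-mono-≤ (≤-reflexive hi) (≤-reflexive hi))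
      (+-mono-≤ (+-mono-≤ (≰⇒> w) (≰⇒> w)) (+-mono-≤ ε≤1 (≤-reflexive m≡ε+2k)))))
    0 (solve (p ∷ i ∷ ε ∷ k ∷ m ∷ []))

  -- For two legs at one vertex. The bound p + q ≤ m excludes both p + q = m + 1 and two descending
  -- positions, so equal levels occur only on the ascending halves, where the owners differ.
  leg-distinct-around : ∀ {a b x y p q} → a ≢ b → 1 ≤ p → 1 ≤ q → p + q ≤ m →
    leg a x p ≢ leg b y q
  leg-distinct-around {p = p} {q} a≢b 1≤p 1≤q near eq
    with p ≤? k | q ≤? k | mirror (≤-trans (m≤m+n p q) near) | mirror (≤-trans (m≤n+m q p) near)
  ... | yes u | yes v | _ | _ = a≢b (proj₂ (atLevel-injective (low≤ u) (low≤ v) eq) 1≤p u)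
  ... | yes u | no v | _ | j , hj , ej rewrite ej
    with atLevel-injective (low≤ u) (high≤ v hj) eq
  ... | refl , _ = absurd-≤ (+-mono-≤ near (≤-reflexive (sym hj))) 0 (solve (j ∷ q ∷ ε ∷ k ∷ m ∷ []))
  leg-distinct-around {p = p} {q} a≢b 1≤p 1≤q near eq | no u | yes v | i , hi , ei | _ rewrite ei
    with atLevel-injective (high≤ u hi) (low≤ v) eq
  ... | refl , _ = absurd-≤ (+-mono-≤ near (≤-reflexive (sym hi))) 0 (solve (i ∷ p ∷ ε ∷ k ∷ m ∷ []))
  leg-distinct-around {p = p} {q} a≢b 1≤p 1≤q near eq | no u | no v | _ | _ =
    absurd-≤ (+-mono-≤ near (+-mono-≤ (+-mono-≤ (≰⇒> u) (≰⇒> v)) (+-mono-≤ ε≤1 (≤-reflexive m≡ε+2k))))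
      0 (solve (p ∷ q ∷ ε ∷ k ∷ m ∷ []))

  -- The colours along an edge of length n whose ends are labelled a and b.
  record Profile (n : ℕ) (a b : Fin Δ) (f : ℕ → Fin #colours) : Set where
    field
      nearSpare farSpare : Fin Δ
      nearSpare≢ : a ≢ nearSpare
      farSpare≢ : b ≢ farSpare
      near : ∀ {p} → p ≤ m → f p ≡ leg a nearSpare p
      far : ∀ {p q} → q ≤ m → p + q ≡ n → f p ≡ leg b farSpare q
      window : ∀ {p q} → p < q → q ≤ n → q ≤ p + m → f p ≢ f q

    window′ : ∀ {p q} → p ≢ q → p ≤ n → q ≤ n → p ≤ q + m → q ≤ p + m → f p ≢ f q
    window′ {p} {q} p≢q p≤n q≤n p≤q+m q≤p+m eq with <-cmp p q
    ... | tri< p<q _ _ = window p<q q≤n q≤p+m eq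
    ... | tri≈ _ p≡q _ = p≢q p≡q
    ... | tri> _ _ q<p = window q<p p≤n p≤q+m (sym eq)

  -- A sequence is chosen once, for the stored orientation of an edge, but the edge must also be
  -- read from its other end.
  reverse : ∀ {n a b f} → m ≤ n → Profile n a b f → Profile n b a (λ p → f (n ∸ p))
  reverse {n} {f = f} m≤n P = record
    { nearSpare = farSpare
    ; farSpare = nearSpare
    ; nearSpare≢ = farSpare≢
    ; farSpare≢ = nearSpare≢
    ; near = λ p≤m → far p≤m (m∸n+n≡m (≤-trans p≤m m≤n))
    ; far = λ { {p} {q} q≤m refl → trans (cong f (m+n∸m≡n p q)) (near q≤m) }
    ; window = λ {p} {q} p<q q≤n q≤p+m eq →
        window (∸-monoʳ-< p<q q≤n) (m∸n≤m n p)
          (farkas (+-mono-≤ q≤p+m (+-mono-≤ (≤-reflexive (m∸n+n≡m (≤-trans (<⇒≤ p<q) q≤n)))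
              (≤-reflexive (sym (m∸n+n≡m q≤n)))))
            0 (shift p q (n ∸ p) (n ∸ q) n))
          (sym eq)
    }
    where
    open Profile P
    shift : ∀ p q p′ q′ n → q + (p′ + p + n) + (q′ + m) ≡ p + m + (n + (q′ + q)) + (p′ + 0)
    shift p q p′ q′ n = solve (p ∷ q ∷ p′ ∷ q′ ∷ n ∷ m ∷ [])

  profile : ∀ {n} → 2 * m + 2 ≤ n → 2 < Δ → m + m < #colours → ∀ a b → ∃ (Profile n a b)
  profile {n} 2m+2≤n 2<Δ 2m<#colours a b = f , record
    { nearSpare = x
    ; farSpare = y
    ; nearSpare≢ = a≢x
    ; farSpare≢ = b≢y
    ; near = λ p≤m → trans (agree (inj₁ (s≤s p≤m))) (ends-near p≤m)
    ; far = λ {p} {q} q≤m pq → trans (agree (inj₂ (rightEnd q≤m pq))) (ends-far q≤m pq)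
    ; window = window
    }
    where
    open Greedy {m = m} {n} 2m<#colours

    x-fresh = fresh {1} (<-trans (s≤s (s≤s z≤n)) 2<Δ) (λ _ → a)
    x = proj₁ x-fresh
    a≢x = proj₂ x-fresh zero

    b-or-x : Fin 2 → Fin Δ
    b-or-x zero = b
    b-or-x (suc _) = x

    -- Two labels are forbidden here, which is why `Δ` must exceed 2.
    y-fresh = fresh 2<Δ b-or-x
    y = proj₁ y-fresh
    b≢y = proj₂ y-fresh zero
    x≢y = proj₂ y-fresh (suc zero)

    ends : ℕ → Fin #colours
    ends p with p ≤? m
    ... | yes _ = leg a x p
    -- Meaningful only within distance `m` of the far end; the values in between are placeholders
    -- that `extend` replaces.
    ... | no _ = leg b y (n ∸ p)

    ends-near : ∀ {p} → p ≤ m → ends p ≡ leg a x p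
    ends-near {p} p≤m with p ≤? m
    ... | yes _ = refl
    ... | no p≰m = contradiction p≤m p≰m

    rightEnd : ∀ {p q} → q ≤ m → p + q ≡ n → n ≤ p + m
    rightEnd {p} q≤m pq = subst (_≤ p + m) pq (+-monoʳ-≤ p q≤m)

    ends-far : ∀ {p q} → q ≤ m → p + q ≡ n → ends p ≡ leg b y q
    ends-far {p} {q} q≤m pq with p ≤? m
    ... | yes p≤m = absurd-≤ (+-mono-≤ (+-mono-≤ p≤m q≤m) (+-mono-≤ (≤-reflexive (sym pq)) 2m+2≤n))
      1 (solve (p ∷ q ∷ m ∷ n ∷ []))
    ... | no _ = cong (leg b y) (trans (cong (_∸ p) (sym pq)) (m+n∸m≡n p q))

    complement : ∀ {p} → p ≤ n → n ≤ p + m → ∃ λ q → p + q ≡ n × q ≤ m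
    complement {p} p≤n n≤p+m = n ∸ p , m+[n∸m]≡n p≤n ,
      +-cancelˡ-≤ p (n ∸ p) m (subst (_≤ p + m) (sym (m+[n∸m]≡n p≤n)) n≤p+m)

    proper : ProperOn (Coloured (suc m)) ends
    proper {p} {q} p<q q≤n q≤p+m (inj₁ (s≤s p≤m)) (inj₁ (s≤s q≤m)) eq =
      leg-distinct-near a≢x p<q q≤m (trans (sym (ends-near p≤m)) (trans eq (ends-near q≤m)))
    proper {p} {q} p<q q≤n q≤p+m (inj₁ (s≤s p≤m)) (inj₂ n≤q+m) eq
      with complement q≤n n≤q+m
    -- From n ≥ 2m + 2 and q ≤ p + m follows p + q′ ≥ m + 2.
    ... | q′ , qq′ , q′≤m = leg-distinct-far x≢y p≤m q′≤m
      (farkas (+-mono-≤ q≤p+m (+-mono-≤ 2m+2≤n (≤-reflexive (sym qq′))))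
        0 (solve (p ∷ q ∷ q′ ∷ m ∷ n ∷ [])))
      (trans (sym (ends-near p≤m)) (trans eq (ends-far q′≤m qq′)))
    -- If `p` is near the far end, so is `q`; seen from there both lie on one leg, with q′ < p′.
    proper {p} {q} p<q q≤n q≤p+m (inj₂ n≤p+m) _ eq
      with complement (≤-trans (<⇒≤ p<q) q≤n) n≤p+m
         | complement q≤n (≤-trans n≤p+m (+-monoˡ-≤ m (<⇒≤ p<q)))
    ... | p′ , pp′ , p′≤m | q′ , qq′ , q′≤m = leg-distinct-near b≢y
      (farkas {suc q′} {p′} (+-mono-≤ p<q (≤-reflexive (trans qq′ (sym pp′)))) 0
        (solve (p ∷ q ∷ p′ ∷ q′ ∷ [])))
      p′≤m (trans (sym (ends-far q′≤m qq′)) (trans (sym eq) (ends-far p′≤m pp′)))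

    extension = extend proper
    f = proj₁ extension
    window = proj₁ (proj₂ extension)
    agree = proj₂ (proj₂ extension)

-- Directed edges.

module Darts (G : FinGraph) where

  private
    Vertex = V (graph G)
    _~_ = Adj (graph G)

  idx : Vertex → ℕ
  idx x = toℕ (Inverse.to (enum G) x)

  idx-injective : ∀ {x y} → idx x ≡ idx y → x ≡ y
  idx-injective {x} {y} eq = trans (sym (Inverse.strictlyInverseʳ (enum G) x))
    (trans (cong (Inverse.from (enum G)) (toℕ-injective eq)) (Inverse.strictlyInverseʳ (enum G) y))

  -- `Edge` stores only the direction of increasing index; darts have both, so that positions can be
  -- measured from either end.
  record Dart : Set where
    constructor dart
    field
      tail head : Vertex
      adj : tail ~ head
  open Dart public

  dart-≡ : ∀ {d d′} → tail d ≡ tail d′ → head d ≡ head d′ → d ≡ d′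
  dart-≡ {dart u v a} {dart _ _ b} refl refl = cong (dart u v) (adjProp G a b)

  flip : Dart → Dart
  flip (dart u v a) = dart v u (symAdj (graph G) a)

  flip-flip : ∀ d → flip (flip d) ≡ d
  flip-flip d = dart-≡ refl refl

  along : Edge G → Dart
  along e = dart (Edge.eu e) (Edge.ev e) (Edge.eadj e)

  edge-≡ : ∀ {e f : Edge G} → Edge.eu e ≡ Edge.eu f → Edge.ev e ≡ Edge.ev f → e ≡ f
  edge-≡ {edge u v a p} {edge _ _ b q} refl refl = cong₂ (edge u v) (adjProp G a b) (<-irrelevant p q)

  along-injective : ∀ {e f} → along e ≡ along f → e ≡ f
  along-injective eq = edge-≡ (cong tail eq) (cong head eq)

  flip-along-injective : ∀ {e f} → flip (along e) ≡ flip (along f) → e ≡ f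
  flip-along-injective eq = edge-≡ (cong head eq) (cong tail eq)

  -- Both stored edges run from smaller to larger index, so one cannot be the reverse of the other.
  along≢flip : ∀ {P : Set} {e f} → along e ≡ flip (along f) → P
  along≢flip {e = e} {f} eq = ⊥-elim (<-asym (Edge.eord e)
    (subst₂ _<_ (cong idx (sym (cong head eq))) (cong idx (sym (cong tail eq))) (Edge.eord f)))

  orientation : ∀ d → (∃ λ e → d ≡ along e) ⊎ (∃ λ e → d ≡ flip (along e))
  orientation d@(dart u v a) with <-cmp (idx u) (idx v)
  ... | tri< u<v _ _ = inj₁ (edge u v a u<v , refl)
  ... | tri> _ _ v<u = inj₂ (edge v u (symAdj (graph G) a) v<u , dart-≡ refl refl)
  ... | tri≈ _ u≡v _ = ⊥-elim (irrAdj (graph G) (subst (u ~_) (sym (idx-injective u≡v)) a))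

-- Positions and short walks in the subdivision.

module Subdivided (G : FinGraph) (n′ : ℕ) where

  open Darts G

  n : ℕ
  n = suc n′

  Point : Set
  Point = SubV G n

  H : Graph
  H = subdivision G n

  -- x lies at distance p from tail d on the path of length n that replaces the edge of d.
  At : Point → Dart → ℕ → Set
  At (inj₁ z) d p = (z ≡ tail d × p ≡ 0) ⊎ (z ≡ head d × p ≡ n)
  At (inj₂ (e , j)) d p =
    (d ≡ along e × p ≡ suc (toℕ j)) ⊎ (d ≡ flip (along e) × p + suc (toℕ j) ≡ n)

  At-≤ : ∀ x {d p} → At x d p → p ≤ n
  At-≤ (inj₁ z) (inj₁ (_ , refl)) = z≤n
  At-≤ (inj₁ z) (inj₂ (_ , refl)) = ≤-refl
  At-≤ (inj₂ (e , j)) (inj₁ (_ , refl)) = s≤s (<⇒≤ (toℕ<n j))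
  At-≤ (inj₂ (e , j)) {p = p} (inj₂ (_ , eq)) = subst (p ≤_) eq (m≤m+n p _)

  At-flip : ∀ x {d p q} → At x d p → p + q ≡ n → At x (flip d) q
  At-flip (inj₁ z) (inj₁ (z≡ , refl)) q≡n = inj₂ (z≡ , q≡n)
  At-flip (inj₁ z) {q = q} (inj₂ (z≡ , refl)) eq =
    inj₁ (z≡ , +-cancelˡ-≡ n q 0 (trans eq (sym (+-identityʳ n))))
  At-flip (inj₂ (e , j)) {q = q} (inj₁ (refl , refl)) eq = inj₂ (refl , trans (+-comm q _) eq)
  At-flip (inj₂ (e , j)) {p = p} {q} (inj₂ (refl , eq′)) eq =
    inj₁ (flip-flip _ , +-cancelˡ-≡ p q _ (trans eq (sym eq′)))

  branch≢interior : ∀ {z y d p} {P : Set} → At (inj₁ z) d p → At (inj₂ y) d p → P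
  branch≢interior (inj₁ (_ , refl)) (inj₁ (_ , ()))
  branch≢interior {y = _ , j} (inj₁ (_ , refl)) (inj₂ (_ , eq)) =
    contradiction (suc-injective eq) (<⇒≢ (toℕ<n j))
  branch≢interior {y = _ , j} (inj₂ (_ , refl)) (inj₁ (_ , eq)) =
    contradiction (sym (suc-injective eq)) (<⇒≢ (toℕ<n j))
  branch≢interior (inj₂ (_ , refl)) (inj₂ (_ , eq)) = contradiction eq (m+1+n≢m n)

  At-unique : ∀ x y {d p} → At x d p → At y d p → x ≡ y
  At-unique (inj₁ z) (inj₁ w) (inj₁ (z≡ , _)) (inj₁ (w≡ , _)) = cong inj₁ (trans z≡ (sym w≡))
  At-unique (inj₁ z) (inj₁ w) (inj₁ (_ , refl)) (inj₂ (_ , ()))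
  At-unique (inj₁ z) (inj₁ w) (inj₂ (_ , refl)) (inj₁ (_ , ()))
  At-unique (inj₁ z) (inj₁ w) (inj₂ (z≡ , _)) (inj₂ (w≡ , _)) = cong inj₁ (trans z≡ (sym w≡))
  At-unique (inj₁ z) (inj₂ y) {d} X Y = branch≢interior {y = y} {d} X Y
  At-unique (inj₂ x) (inj₁ w) {d} X Y = branch≢interior {y = x} {d} Y X
  At-unique (inj₂ (e , i)) (inj₂ (f , j)) (inj₁ (eq , p≡)) (inj₁ (eq′ , p≡′)) =
    cong₂ (λ e i → inj₂ (e , i)) (along-injective (trans (sym eq) eq′))
      (toℕ-injective (suc-injective (trans (sym p≡) p≡′)))
  At-unique (inj₂ (e , _)) (inj₂ (f , _)) (inj₁ (refl , _)) (inj₂ (eq , _)) = along≢flip {e = e} {f} eq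
  At-unique (inj₂ (e , _)) (inj₂ (f , _)) (inj₂ (refl , _)) (inj₁ (eq , _)) =
    along≢flip {e = f} {e} (sym eq)
  At-unique (inj₂ (e , i)) (inj₂ (f , j)) {p = p} (inj₂ (eq , p≡)) (inj₂ (eq′ , p≡′)) =
    cong₂ (λ e i → inj₂ (e , i)) (flip-along-injective (trans (sym eq) eq′))
      (toℕ-injective (suc-injective (+-cancelˡ-≡ p _ _ (trans p≡ (sym p≡′)))))

  Adj→At-half : ∀ x y → Half G n x y → ∃ λ d → ∃ λ p → At x d p × At y d (suc p) × p < n
  Adj→At-half (inj₁ x) (inj₁ y) (n≡1 , a) =
    dart x y a , 0 , inj₁ (refl , refl) , inj₂ (refl , sym n≡1) , s≤s z≤n
  Adj→At-half (inj₁ x) (inj₂ (e , j)) (inj₁ (x≡ , j≡0)) =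
    along e , 0 , inj₁ (x≡ , refl) , inj₁ (refl , cong suc (sym j≡0)) , s≤s z≤n
  Adj→At-half (inj₁ x) (inj₂ (e , j)) (inj₂ (x≡ , sj≡)) =
    flip (along e) , 0 , inj₁ (x≡ , refl) , inj₂ (refl , cong suc sj≡) , s≤s z≤n
  Adj→At-half (inj₂ (e , i)) (inj₂ (f , j)) (eu≡ , ev≡ , si≡j) =
    along e , suc (toℕ i) , inj₁ (refl , refl) , inj₁ (dart-≡ eu≡ ev≡ , cong suc si≡j) , s≤s (toℕ<n i)

  -- Turning the dart when necessary makes every step descend towards the tail. Then `y` is never at
  -- the head, which is the hypothesis of `align`.
  Adj→At : ∀ x y → Adj H x y → ∃ λ d → ∃ λ p → At x d (suc p) × At y d p × p < n
  Adj→At x y (inj₂ h) with Adj→At-half y x h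
  ... | d , p , Y , X , p<n = d , p , X , Y , p<n
  Adj→At x y (inj₁ h) with Adj→At-half x y h
  ... | d , p , X , Y , p<n = flip d , n ∸ suc p ,
    At-flip x X (trans (+-suc p _) (m+[n∸m]≡n p<n)) , At-flip y Y (m+[n∸m]≡n p<n) ,
    s≤s (m∸n≤m n′ p)

  At→Adj : ∀ x y {d p} → At x d p → At y d (suc p) → Adj H x y
  At→Adj (inj₁ z) (inj₁ w) {d} (inj₁ (refl , refl)) (inj₂ (refl , 1≡n)) = inj₁ (sym 1≡n , adj d)
  At→Adj (inj₁ z) (inj₁ w) (inj₂ (_ , refl)) (inj₂ (_ , eq)) = contradiction eq 1+n≢n
  At→Adj (inj₁ z) (inj₂ (e , j)) (inj₁ (z≡ , refl)) (inj₁ (refl , eq)) =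
    inj₁ (inj₁ (z≡ , sym (suc-injective eq)))
  At→Adj (inj₁ z) (inj₂ (e , j)) (inj₁ (z≡ , refl)) (inj₂ (refl , eq)) =
    inj₁ (inj₂ (z≡ , suc-injective eq))
  At→Adj (inj₁ z) y@(inj₂ _) (inj₂ (_ , refl)) Y = contradiction (At-≤ y Y) 1+n≰n
  At→Adj (inj₂ (e , i)) (inj₁ w) (inj₁ (refl , refl)) (inj₂ (w≡ , eq)) =
    inj₂ (inj₂ (w≡ , suc-injective eq))
  At→Adj (inj₂ (e , i)) (inj₁ w) {p = p} (inj₂ (refl , eq)) (inj₂ (w≡ , eq′)) =
    inj₂ (inj₁ (w≡ , suc-injective (+-cancelˡ-≡ p _ 1 (trans eq (trans (sym eq′) (+-comm 1 p))))))
  At→Adj (inj₂ (e , i)) (inj₂ (f , j)) (inj₁ (refl , refl)) (inj₁ (eq , si≡j)) =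
    inj₁ (cong tail eq , cong head eq , suc-injective si≡j)
  At→Adj (inj₂ (e , _)) (inj₂ (f , _)) (inj₁ (refl , _)) (inj₂ (eq , _)) = along≢flip {e = e} {f} eq
  At→Adj (inj₂ (e , _)) (inj₂ (f , _)) (inj₂ (refl , _)) (inj₁ (eq , _)) =
    along≢flip {e = f} {e} (sym eq)
  At→Adj (inj₂ (e , i)) (inj₂ (f , j)) {p = p} (inj₂ (refl , eq)) (inj₂ (eq′ , eq″)) =
    inj₂ (cong head (sym eq′) , cong tail (sym eq′) ,
      suc-injective (+-cancelˡ-≡ p _ _ (trans (+-suc p _) (trans eq″ (sym eq)))))

  point : ∀ d {p} → p < n → ∃ λ x → At x d p
  point d {zero} _ = inj₁ (tail d) , inj₁ (refl , refl)
  point d {suc p} (s≤s p<n′) with orientation d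
  ... | inj₁ (e , d≡) = inj₂ (e , fromℕ< p<n′) , inj₁ (d≡ , cong suc (sym (toℕ-fromℕ< p<n′)))
  -- Position `suc p` of the reversed dart is position n - (p + 1) of `e`, whose interior index is
  -- one less.
  ... | inj₂ (e , d≡) = inj₂ (e , fromℕ< j<n′) , inj₂ (d≡ , cong suc eq)
    where
    j<n′ : n′ ∸ suc p < n′
    j<n′ = ∸-monoʳ-< (s≤s z≤n) p<n′
    eq : p + suc (toℕ (fromℕ< j<n′)) ≡ n′
    eq = trans (cong (λ j → p + suc j) (toℕ-fromℕ< j<n′))
      (trans (+-suc p _) (m+[n∸m]≡n p<n′))

  reach : ∀ d p {x} → p < n → At x d p → Walk H (inj₁ (tail d)) x p
  reach d zero {x} _ X rewrite At-unique x (inj₁ (tail d)) X (inj₁ (refl , refl)) = here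
  reach d (suc p) {x} p<n X with point d (<⇒≤ p<n)
  ... | y , Y = snocW (reach d p (<⇒≤ p<n) Y) (At→Adj y x Y X)

  -- A walk of fewer than n steps meets at most one branch vertex, so its ends share an edge or lie
  -- on two edges at that vertex. The two inequalities of `onEdge` say that the positions differ by
  -- at most `ℓ`; `same` covers an isolated vertex, which lies on no dart.
  data Close (x z : Point) (ℓ : ℕ) : Set where
    same : x ≡ z → Close x z ℓ
    onEdge : ∀ d p q → At x d p → At z d q → p ≤ q + ℓ → q ≤ p + ℓ → Close x z ℓ
    around : ∀ d d′ p q → tail d ≡ tail d′ → At x d p → At z d′ q → p + q ≤ ℓ → Close x z ℓ

  -- How two readings of one point are related once the second dart has been turned if necessary:
  -- they coincide, or the point is the common tail.
  Aligned : Dart → ℕ → Dart → ℕ → Set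
  Aligned d p d′ p′ = (d ≡ d′ × p ≡ p′) ⊎ (p ≡ 0 × p′ ≡ 0 × tail d ≡ tail d′)

  align : ∀ y {d p d′ p′} → At y d p → At y d′ p′ → p < n →
    Aligned d p d′ p′ ⊎ Aligned d p (flip d′) (n ∸ p′)
  align (inj₁ y) (inj₁ (y≡ , p≡0)) (inj₁ (y≡′ , p′≡0)) _ = inj₁ (inj₂ (p≡0 , p′≡0 , trans (sym y≡) y≡′))
  align (inj₁ y) (inj₁ (y≡ , p≡0)) (inj₂ (y≡′ , refl)) _ =
    inj₂ (inj₂ (p≡0 , n∸n≡0 n , trans (sym y≡) y≡′))
  align (inj₁ y) (inj₂ (_ , refl)) _ n<n = contradiction n<n (<-irrefl refl)
  align (inj₂ _) (inj₁ (refl , refl)) (inj₁ (refl , refl)) _ = inj₁ (inj₁ (refl , refl))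
  align (inj₂ (e , j)) {p′ = p′} (inj₁ (refl , refl)) (inj₂ (refl , eq)) _ =
    inj₂ (inj₁ (sym (flip-flip _) , complement p′ eq))
    where
    complement : ∀ p′ {q} → p′ + q ≡ n → q ≡ n ∸ p′
    complement p′ {q} eq = trans (sym (m+n∸m≡n p′ q)) (cong (_∸ p′) eq)
  align (inj₂ (e , j)) {p = p} (inj₂ (refl , eq)) (inj₁ (refl , refl)) _ =
    inj₂ (inj₁ (refl , trans (sym (m+n∸n≡m p (suc (toℕ j)))) (cong (_∸ suc (toℕ j)) eq)))
  align (inj₂ (e , j)) {p = p} {p′ = p′} (inj₂ (refl , eq)) (inj₂ (refl , eq′)) _ =
    inj₁ (inj₁ (refl , +-cancelʳ-≡ (suc (toℕ j)) p p′ (trans eq (sym eq′))))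

  step-onEdge : ∀ {x z d p d′ p′ q ℓ} → At x d (suc p) → At z d′ q → p′ ≤ q + ℓ → q ≤ p′ + ℓ →
    Aligned d p d′ p′ → Close x z (suc ℓ)
  step-onEdge {d = d} {p} {q = q} {ℓ} X Z p≤ q≤ (inj₁ (refl , refl)) =
    onEdge d (suc p) q X Z (subst (suc p ≤_) (sym (+-suc q ℓ)) (s≤s p≤))
      (≤-trans q≤ (≤-trans (+-monoʳ-≤ p (n≤1+n ℓ)) (n≤1+n _)))
  -- The walk leaves the edge of `d′` through its tail, so `x` is one step out on `d`.
  step-onEdge {d = d} {d′ = d′} {q = q} X Z p≤ q≤ (inj₂ (refl , refl , t)) =
    around d d′ 1 q t X Z (s≤s q≤)

  step-around : ∀ {x z d p d′ p′ e q ℓ} → At x d (suc p) → p < n → At z e q →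
    tail d′ ≡ tail e → p′ + q ≤ ℓ → p′ < n →
    Aligned d p d′ p′ ⊎ Aligned d p (flip d′) (n ∸ p′) → Close x z (suc ℓ)
  step-around {d = d} {p} {e = e} {q} X _ Z t ≤ℓ _ (inj₁ (inj₁ (refl , refl))) =
    around d e (suc p) q t X Z (s≤s ≤ℓ)
  step-around {d = d} {e = e} {q} X _ Z t ≤ℓ _ (inj₁ (inj₂ (refl , refl , t′))) =
    around d e 1 q (trans t′ t) X Z (s≤s ≤ℓ)
  -- Here the step goes back towards the common vertex, so the old bound suffices.
  step-around {x} {d′ = d′} {p′} {e} {q} {ℓ} X p<n Z t ≤ℓ p′<n (inj₂ (inj₁ (refl , refl))) =
    around d′ e (n ∸ suc (n ∸ p′)) q t
      (subst (λ d → At x d (n ∸ suc (n ∸ p′))) (flip-flip d′) (At-flip x X (m+[n∸m]≡n p<n)))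
      Z (≤-trans (+-monoˡ-≤ q shorter) (m≤n⇒m≤1+n ≤ℓ))
    where
    shorter : n ∸ suc (n ∸ p′) ≤ p′
    shorter = ≤-trans (∸-monoʳ-≤ n (n≤1+n (n ∸ p′))) (≤-reflexive (m∸[m∸n]≡n (<⇒≤ p′<n)))
  -- This would put the point at the head of `d′`, a second branch vertex, which needs p′ = n.
  step-around X _ Z t ≤ℓ p′<n (inj₂ (inj₂ (_ , eq , _))) =
    contradiction (m∸n≡0⇒m≤n eq) (<⇒≱ p′<n)

  close : ∀ {x z ℓ} → Walk H x z ℓ → ℓ < n → Close x z ℓ
  close here _ = same refl
  close {x} {z} {suc ℓ} (step {y = y} a w) ℓ<n with close w (<⇒≤ ℓ<n) | Adj→At x y a
  ... | same refl | d , p , X , Y , p<n = onEdge d (suc p) p X Y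
    (subst (suc p ≤_) (sym (+-suc p ℓ)) (s≤s (m≤m+n p ℓ)))
    (≤-trans (n≤1+n p) (m≤m+n (suc p) (suc ℓ)))
  ... | around d′ e p′ q t Y′ Z ≤ℓ | d , p , X , Y , p<n =
    step-around X p<n Z t ≤ℓ (≤-<-trans (≤-trans (m≤m+n p′ q) ≤ℓ) (<⇒≤ ℓ<n)) (align y Y Y′ p<n)
  ... | onEdge d′ p′ q Y′ Z p≤ q≤ | d , p , X , Y , p<n with align y Y Y′ p<n
  ... | inj₁ A = step-onEdge X Z p≤ q≤ A
  -- Reading the edge from its other end turns `z` as well and exchanges the two inequalities.
  ... | inj₂ A = step-onEdge X (At-flip z Z (m+[n∸m]≡n (At-≤ z Z)))
      (turn q p′ (At-≤ z Z) (At-≤ y Y′) q≤) (turn p′ q (At-≤ y Y′) (At-≤ z Z) p≤) A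
    where
    turn : ∀ q p → q ≤ n → p ≤ n → q ≤ p + ℓ → n ∸ p ≤ n ∸ q + ℓ
    turn q p q≤n p≤n q≤ = farkas
      (+-mono-≤ q≤ (≤-reflexive (trans (m∸n+n≡m p≤n) (sym (m∸n+n≡m q≤n))))) 0
      (identity q p (n ∸ q) (n ∸ p))
      where
      identity : ∀ q p q′ p′ → q + (p′ + p) + (q′ + ℓ) ≡ p + ℓ + (q′ + q) + (p′ + 0)
      identity q p q′ p′ = solve (p ∷ q ∷ p′ ∷ q′ ∷ ℓ ∷ [])

-- Maximum degree and local edge labels.

lookup-injective : ∀ {A : Set} {xs : List A} → Unique xs →
  ∀ i j → lookup xs i ≡ lookup xs j → i ≡ j
lookup-injective (_ AllPairs.∷ _) zero zero _ = refl
lookup-injective (x∉ AllPairs.∷ _) zero (suc j) eq = contradiction eq (All.lookup x∉ (∈-lookup j))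
lookup-injective (x∉ AllPairs.∷ _) (suc i) zero eq = contradiction (sym eq) (All.lookup x∉ (∈-lookup i))
lookup-injective (_ AllPairs.∷ u) (suc i) (suc j) eq = cong suc (lookup-injective u i j eq)

-- Labels need to differ only among darts with a common tail; the two ends of an edge are labelled
-- independently. The spokes leave a vertex of degree `Δ` and will carry the clique.
record Labelling (G : FinGraph) : Set where
  open Darts G
  field
    Δ : ℕ
    label : Dart → Fin Δ
    label-injective : ∀ {d d′} → tail d ≡ tail d′ → label d ≡ label d′ → d ≡ d′
    spoke : Fin Δ → Dart
    spoke-tail : ∀ i j → tail (spoke i) ≡ tail (spoke j)
    spoke-injective : ∀ {i j} → spoke i ≡ spoke j → i ≡ j
    Δ-max : ∀ {d} → MaxDegreeAtLeast (graph G) d → d ≤ Δ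

labelling : (G : FinGraph) → V (graph G) → Labelling G
labelling G v₀ = record
  { Δ = degree hub
  -- The label is the place of the head in the neighbour list of the tail.
  ; label = λ d → Fin.inject≤ (rank d) (hub-max (tail d))
  ; label-injective = λ {d} {d′} t eq →
      rank-injective d d′ t (trans (sym (Finₚ.toℕ-inject≤ (rank d) _))
        (trans (cong toℕ eq) (Finₚ.toℕ-inject≤ (rank d′) _)))
  ; spoke = λ i → dart hub (lookup (nbrs hub) i)
      (proj₂ (∈-filter⁻ (adj? G hub) {xs = vertices} (∈-lookup i)))
  ; spoke-tail = λ _ _ → refl
  ; spoke-injective = λ {i} {j} eq → lookup-injective nbrs-unique i j (cong head eq)
  ; Δ-max = λ { (v , f , f-inj , f-adj) → ≤-trans
      (Finₚ.injective⇒≤ {f = λ i → rank (dart v (f i) (f-adj i))} λ {i} {j} eq →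
        f-inj i j (cong head
          (rank-injective (dart v (f i) (f-adj i)) (dart v (f j) (f-adj j)) refl (cong toℕ eq))))
      (hub-max v) }
  }
  where
  open Darts G

  vertices : List (V (graph G))
  vertices = map (Inverse.from (enum G)) (allFin (N G))

  vertices-complete : ∀ v → v ∈ vertices
  vertices-complete v = subst (_∈ vertices) (Inverse.strictlyInverseʳ (enum G) v)
    (∈-map⁺ (Inverse.from (enum G)) (∈-allFin (Inverse.to (enum G) v)))

  nbrs : V (graph G) → List (V (graph G))
  nbrs v = filter (adj? G v) vertices

  nbrs-unique : ∀ {v} → Unique (nbrs v)
  nbrs-unique {v} = Uniqueₚ.filter⁺ (adj? G v) (Uniqueₚ.map⁺
    (λ {i} {j} eq → trans (sym (Inverse.strictlyInverseˡ (enum G) i))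
      (trans (cong (Inverse.to (enum G)) eq) (Inverse.strictlyInverseˡ (enum G) j)))
    (Uniqueₚ.allFin⁺ (N G)))

  degree : V (graph G) → ℕ
  degree = length ∘ nbrs

  hub : V (graph G)
  -- `v₀` is the default that `argmax` requires.
  hub = argmax degree v₀ vertices

  hub-max : ∀ v → degree v ≤ degree hub
  hub-max v = All.lookup (f[xs]≤f[argmax] {f = degree} v₀ vertices) (vertices-complete v)

  head∈nbrs : ∀ d → head d ∈ nbrs (tail d)
  head∈nbrs d = ∈-filter⁺ (adj? G (tail d)) (vertices-complete (head d)) (adj d)

  rank : ∀ d → Fin (degree (tail d))
  rank d = index (head∈nbrs d)

  rank-injective : ∀ d d′ → tail d ≡ tail d′ → toℕ (rank d) ≡ toℕ (rank d′) → d ≡ d′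
  rank-injective d@(dart _ _ _) d′@(dart _ _ _) refl eq = dart-≡ refl
    (trans (lookup-index (head∈nbrs d)) (trans (cong (lookup (nbrs (tail d))) (toℕ-injective eq))
      (sym (lookup-index (head∈nbrs d′)))))

-- A clique receives distinct colours. Hence a clique and a colouring of equal size are both
-- optimal.
pigeonhole-clique : ∀ H {r s} → Colourable H r → HasClique H s → s ≤ r
pigeonhole-clique H (c , proper) (f , clique) = Finₚ.injective⇒≤ {f = c ∘ f} λ {i} {j} eq →
  decidable-stable (i Fin.≟ j) λ i≢j → proper (f i) (f j) (clique i j i≢j) eq

-- The colouring and the clique of the fractional power.

module Colouring (G : FinGraph) (L : Labelling G) (k ε m n′ : ℕ)
  (ε≤1 : ε ≤ 1) (m≡ε+2k : m ≡ ε + 2 * k) (2m+2≤n : 2 * m + 2 ≤ suc n′) where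

  open Labelling L
  open Darts G
  open Subdivided G n′
  open Palette Δ k ε m ε≤1 m≡ε+2k

  m<n : m < n
  m<n = farkas {q = suc n′} 2m+2≤n (1 + m) (solve (m ∷ n′ ∷ []))

  m≤n = <⇒≤ m<n

  module _ (2<Δ : 2 < Δ) (2m<#colours : m + m < #colours) where

    sequence : ∀ a b → ∃ (Profile n a b)
    sequence = profile 2m+2≤n 2<Δ 2m<#colours

    colour : Point → Fin #colours
    colour (inj₁ _) = encode (inj₁ zero)
    colour (inj₂ (e , j)) = proj₁ (sequence (label (along e)) (label (flip (along e)))) (suc (toℕ j))

    -- Makes the colouring readable along either direction of an edge, branch vertices included.
    OnDart : Dart → Set
    OnDart d = ∃ λ f → Profile n (label d) (label (flip d)) f × (∀ x {p} → At x d p → colour x ≡ f p)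

    onDart-along : ∀ e → OnDart (along e)
    onDart-along e = f , P , agree
      where
      f = proj₁ (sequence (label (along e)) (label (flip (along e))))
      P = proj₂ (sequence (label (along e)) (label (flip (along e))))
      open Profile P
      agree : ∀ x {p} → At x (along e) p → colour x ≡ f p
      agree (inj₁ _) (inj₁ (_ , refl)) = sym (trans (near z≤n) (leg-0 (label (along e)) nearSpare))
      agree (inj₁ _) (inj₂ (_ , refl)) =
        sym (trans (far z≤n (+-identityʳ n)) (leg-0 (label (flip (along e))) farSpare))
      agree (inj₂ (e′ , j)) (inj₁ (eq , refl)) with along-injective {e} {e′} eq
      ... | refl = refl
      agree (inj₂ (e′ , j)) (inj₂ (eq , _)) = along≢flip {e = e} {e′} eq

    onDart-flip : ∀ d → OnDart d → OnDart (flip d)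
    onDart-flip d (f , P , agree) = (λ p → f (n ∸ p)) ,
      subst (λ d′ → Profile n (label (flip d)) (label d′) (λ p → f (n ∸ p))) (sym (flip-flip d))
        (reverse m≤n P) ,
      λ x X → agree x (subst (λ d → At x d _) (flip-flip d) (At-flip x X (m+[n∸m]≡n (At-≤ x X))))

    onDart : ∀ d → OnDart d
    onDart d with orientation d
    ... | inj₁ (e , refl) = onDart-along e
    ... | inj₂ (e , refl) = onDart-flip (along e) (onDart-along e)

    colour-onEdge : ∀ {x z} → x ≢ z → ∀ d p q → At x d p → At z d q → p ≤ q + m → q ≤ p + m →
      colour x ≢ colour z
    colour-onEdge {x} {z} x≢z d p q X Z p≤ q≤ eq =
      let f , P , agree = onDart d in
      Profile.window′ P (λ { refl → x≢z (At-unique x z X Z) }) (At-≤ x X) (At-≤ z Z) p≤ q≤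
        (trans (sym (agree x X)) (trans eq (agree z Z)))

    At-0 : ∀ {v x d} → At x d 0 → v ≡ tail d → x ≡ inj₁ v
    At-0 {x = x} {d} X refl = At-unique x (inj₁ (tail d)) X (inj₁ (refl , refl))

    -- A point at position 0 is the common tail and so lies on the other dart too; equal labels make
    -- the darts equal. Both cases reduce to a single edge, and otherwise the legs have distinct
    -- owners.
    colour-around : ∀ {x z} → x ≢ z → ∀ d d′ p q → tail d ≡ tail d′ → At x d p → At z d′ q →
      p + q ≤ m → colour x ≢ colour z
    colour-around {x} x≢z d d′ zero q t X Z ≤m = colour-onEdge x≢z d′ 0 q
      (subst (λ x → At x d′ 0) (sym (At-0 {x = x} X (sym t))) (inj₁ (refl , refl))) Z z≤n ≤m
    colour-around {z = z} x≢z d d′ p@(suc _) zero t X Z ≤m = colour-onEdge x≢z d p 0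
      X (subst (λ z → At z d 0) (sym (At-0 {x = z} Z t)) (inj₁ (refl , refl)))
      (subst (_≤ m) (+-identityʳ p) ≤m) z≤n
    colour-around {x} {z} x≢z d d′ p@(suc _) q@(suc _) t X Z ≤m eq with label d Fin.≟ label d′
    ... | yes same-label with label-injective t same-label
    ... | refl = colour-onEdge x≢z d p q X Z (≤-trans p≤m (m≤n+m m q)) (≤-trans q≤m (m≤n+m m p)) eq
      where
      p≤m = ≤-trans (m≤m+n p q) ≤m
      q≤m = ≤-trans (m≤n+m q p) ≤m
    colour-around {x} {z} x≢z d d′ p@(suc _) q@(suc _) t X Z ≤m eq | no distinct =
      let f , P , agree = onDart d
          g , Q , agree′ = onDart d′ in
      leg-distinct-around distinct (s≤s z≤n) (s≤s z≤n) ≤m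
        (trans (sym (Profile.near P (≤-trans (m≤m+n p q) ≤m)))
          (trans (sym (agree x X)) (trans eq (trans (agree′ z Z)
            (Profile.near Q (≤-trans (m≤n+m q p) ≤m))))))

    colourable : Colourable (fracPower G m n) #colours
    colourable = colour , proper
      where
      proper : ∀ x z → PowAdj H m x z → colour x ≢ colour z
      proper x z (x≢z , ℓ , _ , ℓ≤m , w) with close w (≤-<-trans ℓ≤m m<n)
      ... | same x≡z = contradiction x≡z x≢z
      ... | onEdge d p q X Z p≤ q≤ =
        colour-onEdge x≢z d p q X Z (≤-trans p≤ (+-monoʳ-≤ q ℓ≤m)) (≤-trans q≤ (+-monoʳ-≤ p ℓ≤m))
      ... | around d d′ p q t X Z ≤ℓ = colour-around x≢z d d′ p q t X Z (≤-trans ≤ℓ ℓ≤m)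

  module _ (2<Δ : 2 < Δ) (1≤k : 1 ≤ k) where

    -- Indexing the clique by `Colour` gives it the right size at once. The hub and, for odd m, the
    -- point at distance `k + 1` are placed on spoke 0.
    ray : Colour → Fin Δ
    ray (inj₁ _) = fromℕ< (≤-trans (s≤s z≤n) 2<Δ)
    ray (inj₂ (a , _)) = a

    distance : Colour → ℕ
    distance (inj₁ zero) = 0
    distance (inj₁ (suc _)) = suc k
    distance (inj₂ (_ , i)) = suc (toℕ i)

    distance-0 : ∀ {x} → distance x ≡ 0 → x ≡ inj₁ zero
    distance-0 {inj₁ zero} _ = refl

    Fin-ε-irrelevant : (c d : Fin ε) → c ≡ d
    Fin-ε-irrelevant c d = toℕ-injective (trans (is-0 c) (sym (is-0 d)))
      where
      is-0 : (c : Fin ε) → toℕ c ≡ 0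
      is-0 c = n<1⇒n≡0 (<-≤-trans (toℕ<n c) ε≤1)

    ray-distance-injective : ∀ x y → ray x ≡ ray y → distance x ≡ distance y → x ≡ y
    ray-distance-injective (inj₁ zero) y _ eq = sym (distance-0 (sym eq))
    ray-distance-injective (inj₁ (suc c)) (inj₁ (suc d)) _ _ = cong (inj₁ ∘ suc) (Fin-ε-irrelevant c d)
    ray-distance-injective (inj₁ (suc _)) (inj₂ (_ , j)) _ eq =
      contradiction (sym (suc-injective eq)) (<⇒≢ (toℕ<n j))
    ray-distance-injective (inj₂ (_ , i)) (inj₁ (suc _)) _ eq =
      contradiction (suc-injective eq) (<⇒≢ (toℕ<n i))
    ray-distance-injective (inj₂ (_ , i)) (inj₂ (_ , j)) refl eq =
      cong (λ i → inj₂ (_ , i)) (toℕ-injective (suc-injective eq))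

    distance≤ : ∀ x → distance x ≤ k ⊎ ∃ λ c → x ≡ inj₁ (suc c)
    distance≤ (inj₁ zero) = inj₁ z≤n
    distance≤ (inj₁ (suc c)) = inj₂ (c , refl)
    distance≤ (inj₂ (_ , i)) = inj₁ (toℕ<n i)

    -- At most one point has distance `k + 1`, and it exists only if `ε` is 1; so the sum is at most
    -- 2k + ε.
    distance-sum : ∀ x y → x ≢ y → distance x + distance y ≤ m
    distance-sum x y x≢y with distance≤ x | distance≤ y
    ... | inj₁ p | inj₁ q = ≤-trans (+-mono-≤ p q)
      (farkas (≤-reflexive (sym m≡ε+2k)) ε (solve (k ∷ ε ∷ m ∷ [])))
    ... | inj₁ p | inj₂ (c , refl) = farkas
      (+-mono-≤ p (+-mono-≤ (≤-trans (s≤s z≤n) (toℕ<n c)) (≤-reflexive (sym m≡ε+2k))))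
      0 (identity (distance x))
      where
      identity : ∀ p → p + (1 + (ε + 2 * k)) + m ≡ k + (ε + m) + (p + suc k + 0)
      identity p = solve (p ∷ k ∷ ε ∷ m ∷ [])
    ... | inj₂ (c , refl) | inj₁ q = farkas
      (+-mono-≤ q (+-mono-≤ (≤-trans (s≤s z≤n) (toℕ<n c)) (≤-reflexive (sym m≡ε+2k))))
      0 (identity (distance y))
      where
      identity : ∀ q → q + (1 + (ε + 2 * k)) + m ≡ k + (ε + m) + (suc k + q + 0)
      identity q = solve (q ∷ k ∷ ε ∷ m ∷ [])
    ... | inj₂ (c , refl) | inj₂ (d , refl) =
      contradiction (cong (inj₁ ∘ suc) (Fin-ε-irrelevant c d)) x≢y

    distance≤1+k : ∀ x → distance x ≤ suc k
    distance≤1+k x with distance≤ x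
    ... | inj₁ p = m≤n⇒m≤1+n p
    ... | inj₂ (_ , refl) = ≤-refl

    2[1+k]<n : suc k + suc k < n
    2[1+k]<n = farkas {q = suc n′} (+-mono-≤ (+-mono-≤ 1≤k 1≤k) (+-mono-≤ 2m+2≤n
      (+-mono-≤ (≤-reflexive (sym m≡ε+2k)) (≤-reflexive (sym m≡ε+2k)))))
      (1 + 2 * ε) (solve (k ∷ ε ∷ m ∷ n′ ∷ []))

    distance<n : ∀ x → distance x < n
    distance<n x = ≤-<-trans (≤-trans (distance≤1+k x) (m≤m+n (suc k) (suc k))) 2[1+k]<n

    place : ∀ x → ∃ λ z → At z (spoke (ray x)) (distance x)
    place x = point (spoke (ray x)) (distance<n x)

    place-injective : ∀ x y → proj₁ (place x) ≡ proj₁ (place y) → x ≡ y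
    place-injective x y eq with place x | place y
    ... | z , X | z′ , Y with eq
    ... | refl with align z X Y (distance<n x)
    ... | inj₁ (inj₁ (d≡ , p≡)) = ray-distance-injective x y (spoke-injective d≡) p≡
    ... | inj₁ (inj₂ (p≡0 , q≡0 , _)) = trans (distance-0 p≡0) (sym (distance-0 q≡0))
    ... | inj₂ (inj₂ (_ , n∸q≡0 , _)) = contradiction (m∸n≡0⇒m≤n n∸q≡0) (<⇒≱ (distance<n y))
    -- One point read from opposite ends of an edge would make the two distances sum to `n`, but
    -- they sum to at most 2k + 2.
    ... | inj₂ (inj₁ (_ , p≡n∸q)) =
      contradiction (≤-<-trans (+-mono-≤ (distance≤1+k x) (distance≤1+k y)) 2[1+k]<n)
        (<-irrefl (trans (cong (_+ distance y) p≡n∸q) (m∸n+n≡m (<⇒≤ (distance<n y)))))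

    infixr 5 _++W_
    _++W_ : ∀ {x y z p q} → Walk H x y p → Walk H y z q → Walk H x z (p + q)
    here ++W w = w
    step a v ++W w = step a (v ++W w)

    clique : HasClique (fracPower G m n) #colours
    clique = (λ c → proj₁ (place (decode c))) , λ i j i≢j → adjacent _ _ (i≢j ∘ decode-injective)
      where
      adjacent : ∀ x y → x ≢ y → PowAdj H m (proj₁ (place x)) (proj₁ (place y))
      adjacent x y x≢y = x≢y ∘ place-injective x y , distance x + distance y ,
        n≢0⇒n>0 (λ eq → x≢y (trans (distance-0 (m+n≡0⇒m≡0 _ eq)) (sym (distance-0 (m+n≡0⇒n≡0 _ eq))))) ,
        distance-sum x y x≢y ,
        -- The walk goes from one point to the hub and out to the other.
        revW (reach _ _ (distance<n x) (proj₂ (place x))) ++W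
          subst (λ v → Walk H (inj₁ v) (proj₁ (place y)) (distance y)) (spoke-tail (ray y) (ray x))
            (reach _ _ (distance<n y) (proj₂ (place y)))

-- Both parities together.

χ≡ω : (G : FinGraph) (k ε m : ℕ) → 1 ≤ k → ε ≤ 1 → m ≡ ε + 2 * k →
  MaxDegreeAtLeast (graph G) (4 + ε) → ∀ n → 2 * m + 2 ≤ n → ChiEqOmega (fracPower G m n)
χ≡ω G k ε m _ _ _ _ zero 2m+2≤0 = absurd-≤ 2m+2≤0 (suc (2 * m)) (solve (m ∷ []))
χ≡ω G k ε m 1≤k ε≤1 m≡ε+2k Δ≥4+ε (suc n′) 2m+2≤n =
  _ , (C , λ _ c → pigeonhole-clique F c K) , (K , λ _ → pigeonhole-clique F C)
  where
  F = fracPower G m (suc n′)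
  L = labelling G (proj₁ Δ≥4+ε)
  open Labelling L using (Δ; Δ-max)
  open Colouring G L k ε m n′ ε≤1 m≡ε+2k 2m+2≤n

  4+ε≤Δ : 4 + ε ≤ Δ
  4+ε≤Δ = Δ-max Δ≥4+ε

  2<Δ : 2 < Δ
  2<Δ = ≤-trans (m≤m+n 3 (suc ε)) 4+ε≤Δ

  -- Since k ≥ 1, 1 + ε + Δk ≥ 1 + ε + (4 + ε)k ≥ 1 + 2ε + 4k = 2m + 1.
  2m<#colours : m + m < suc ε + Δ * k
  2m<#colours = farkas
    (+-mono-≤ (+-mono-≤ (≤-reflexive m≡ε+2k) (≤-reflexive m≡ε+2k))
      (+-mono-≤ (*-monoˡ-≤ k 4+ε≤Δ) (*-monoʳ-≤ ε 1≤k)))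
    0 (identity Δ)
    where
    identity : ∀ Δ → m + m + ((4 + ε) * k + ε * 1) + (suc ε + Δ * k)
      ≡ ε + 2 * k + (ε + 2 * k) + (Δ * k + ε * k) + (suc (m + m) + 0)
    identity Δ = solve (k ∷ ε ∷ m ∷ Δ ∷ [])

  C = colourable 2<Δ 2m<#colours
  K = clique 2<Δ 1≤k

1<2k⇒1≤k : ∀ {ε} k → ε ≤ 1 → 1 < ε + 2 * k → 1 ≤ k
1<2k⇒1≤k zero ε≤1 1<ε = contradiction ε≤1 (<⇒≱ (subst (1 <_) (+-identityʳ _) 1<ε))
1<2k⇒1≤k (suc k) _ _ = s≤s z≤n

theorem5 : (G : FinGraph) → Connected (graph G) → (m : ℕ) → 1 < m →
    (Even m → MaxDegreeAtLeast (graph G) 4 →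
    ∀ n → 2 * m + 2 ≤ n → ChiEqOmega (fracPower G m n))
    ×
    (Odd m → MaxDegreeAtLeast (graph G) 5 →
    ∀ n → 2 * m + 2 ≤ n → ChiEqOmega (fracPower G m n))
theorem5 G _ m 1<m =
  (λ (k , m≡) → χ≡ω G k 0 m (1<2k⇒1≤k k z≤n (subst (1 <_) m≡ 1<m)) z≤n m≡) ,
  (λ (k , m≡) → χ≡ω G k 1 m (1<2k⇒1≤k k ≤-refl (subst (1 <_) m≡ 1<m)) ≤-refl m≡)
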